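{- Let $S$ be a uniformly recurrent laminary set on a finite alphabet $A$ relative to an involution $\theta$. Any finite symmetric bifix code $X\subset S$ is contained in a finite symmetric $S$-maximal bifix code.
   Context: Words are over a finite alphabet $A$. A set $S$ of words on $A$ is factorial if it contains $A$ and all the factors of its elements; it is biextendable if moreover for every $w\in S$ there are $a,b\in A$ with $awb\in S$. An infinite factorial set $S$ is uniformly recurrent if for every $u\in S$ there is an integer $n\ge1$ such that $u$ is a factor of every word of $S$ of length $n$. Let $\theta$ be an involution on $A$ (possibly with fixed points) and let $G_\theta$ be the group generated by $A$ with relations $a\theta(a)=1$, $a\in A$ (so $a^{ -1}=\theta(a)$). A word is reduced if it has no factor $a\theta(a)$ with $a\in A$; the inverse of a reduced word $a_1\cdots a_n$ is the reduced word $\theta(a_n)\cdots\theta(a_1)$. A laminary set on $A$ relative to $\theta$ is a biextendable set of reduced words closed under taking inverses. A set of reduced words is symmetric if it is closed under taking inverses. A bifix code is a set of nonempty words in which no element is a proper prefix or a proper suffix of another. A bifix code $X\subset S$ is $S$-maximal if it is not properly contained in a bifix code $Y\subset S$. -}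

module Defs where

open import Level using (0ℓ)
open import Data.Fin using (Fin)
open import Data.List using (List; []; _∷_; [_]; _++_; length; map; reverse)
open import Data.List.Membership.Propositional using () renaming (_∈_ to _∈ˡ_)
open import Data.List.Relation.Binary.Infix.Heterogeneous using (Infix)
open import Data.List.Relation.Binary.Prefix.Heterogeneous using (Prefix)
open import Data.List.Relation.Binary.Suffix.Heterogeneous using (Suffix)
open import Data.Nat using (ℕ; _≤_)
open import Data.Product using (_×_; ∃-syntax)
open import Function.Bundles using (_↔_)
open import Relation.Binary.PropositionalEquality using (_≡_; _≢_)
open import Relation.Nullary using (¬_)
open import Relation.Unary using (Pred; _∈_; _⊆_; _⊂_; _≐_)

IsFiniteType : Set → Set
IsFiniteType A = ∃[ k ] (A ↔ Fin k)

Word : Set → Set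
Word A = List A

WordSet : Set → Set₁
WordSet A = Pred (Word A) 0ℓ

module _ {A : Set} where

  Factor ProperPrefix ProperSuffix : Word A → Word A → Set
  Factor       = Infix _≡_
  ProperPrefix u w = Prefix _≡_ u w × u ≢ w
  ProperSuffix u w = Suffix _≡_ u w × u ≢ w

  Finite : WordSet A → Set
  Finite X = ∃[ ws ] (X ≐ (_∈ˡ ws))

  Infinite : WordSet A → Set
  Infinite X = ¬ Finite X

  record Factorial (S : WordSet A) : Set where
    field
      letters : ∀ a → [ a ] ∈ S
      factors : ∀ {u w} → w ∈ S → Factor u w → u ∈ S

  record Biextendable (S : WordSet A) : Set where
    field
      factorial : Factorial S
      extend    : ∀ {w} → w ∈ S → ∃[ a ] ∃[ b ] ([ a ] ++ w ++ [ b ]) ∈ S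

  record UniformlyRecurrent (S : WordSet A) : Set where
    field
      infinite  : Infinite S
      factorial : Factorial S
      recurrent : ∀ {u} → u ∈ S →
                  ∃[ n ] (1 ≤ n × (∀ {w} → w ∈ S → length w ≡ n → Factor u w))

  record BifixCode (X : WordSet A) : Set where
    field
      nonempty   : ∀ {w} → w ∈ X → w ≢ []
      prefixFree : ∀ {u w} → u ∈ X → w ∈ X → ¬ ProperPrefix u w
      suffixFree : ∀ {u w} → u ∈ X → w ∈ X → ¬ ProperSuffix u w

  -- Maximality is among all bifix codes included in S, symmetric or not,
  -- finite or infinite.
  record MaximalBifixCode (S X : WordSet A) : Set₁ where
    field
      bifix   : BifixCode X
      within  : X ⊆ S
      maximal : ∀ (Y : WordSet A) → BifixCode Y → Y ⊆ S → ¬ (X ⊂ Y)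

  -- θ a plays the role of the inverse of the letter a, so a reduced word
  -- represents an element of the group ⟨ A ∣ a θ(a) = 1 ⟩.
  module _ (θ : A → A) where

    Reduced : Word A → Set
    Reduced w = ∀ a → ¬ Factor (a ∷ θ a ∷ []) w

    inverse : Word A → Word A
    inverse w = reverse (map θ w)

    ClosedUnderInverse : WordSet A → Set
    ClosedUnderInverse X = ∀ {w} → w ∈ X → inverse w ∈ X

    record Symmetric (X : WordSet A) : Set where
      field
        reduced : X ⊆ Reduced
        closed  : ClosedUnderInverse X

    record Laminary (S : WordSet A) : Set where
      field
        biextendable : Biextendable S
        reduced      : S ⊆ Reduced
        closed       : ClosedUnderInverse S

{-# OPTIONS --safe #-}

-- For a finite bifix code X let L w be the number of parses of w: the number of
-- suffixes of w, the empty one included, that have no prefix in X. Since X is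
-- symmetric and prefix-free, L (inverse w) = L w. Let d bound the lengths of the
-- words of X and cut a ∷ v off as soon as it has a prefix in X or d ≤ L v. The
-- minimal words Y to be cut off are prefix-free and contain X. When a v b is
-- minimal and not in X, L v = d − 1 and neither a v nor b⁻¹ v⁻¹ has a prefix in X,
-- a condition invariant under inversion; so Y is symmetric, and hence suffix-free.
-- By uniform recurrence every long word of S contains a word u of S which
-- maximises min(d, L u), and is therefore cut off: so Y is finite, and every word
-- of S extends to one with a prefix in Y, which gives maximality.
module Submission where

open import Defs
open import Level using (0ℓ)
open import Algebra.Definitions using (Involutive)
open import Axiom.ExcludedMiddle using (ExcludedMiddle)
open import Data.Empty using (⊥; ⊥-elim)
open import Data.List
  using (List; []; _∷_; [_]; _++_; _∷ʳ_; length; map; reverse; filter; take; drop; allFin;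
         cartesianProductWith; initLast; _∷ʳ′_)
open import Data.List.Extrema.Nat using (max; xs≤max)
open import Data.List.Membership.Propositional using () renaming (_∈_ to _∈ˡ_)
open import Data.List.Membership.Propositional.Properties
  using (∈-cartesianProductWith⁺; ∈-filter⁺; ∈-filter⁻; ∈-map⁺; ∈-allFin)
open import Data.List.Properties
  using (map-id; map-∘; map-cong; map-++; length-take; length-++; ++-assoc; ++-identityʳ;
         take++drop≡id; reverse-++; reverse-involutive; reverse-map)
open import Data.List.Relation.Binary.Infix.Heterogeneous using (here; there; _ⁱ++_)
open import Data.List.Relation.Binary.Pointwise using (≡⇒Pointwise-≡; Pointwise-≡⇒≡)
open import Data.List.Relation.Binary.Prefix.Heterogeneous using (Prefix; []; _∷_; _++ᵖ_)
import Data.List.Relation.Binary.Prefix.Heterogeneous.Properties as Prefixₚ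
open import Data.List.Relation.Binary.Suffix.Heterogeneous as Suffixₘ using (Suffix)
import Data.List.Relation.Binary.Suffix.Heterogeneous.Properties as Suffixₚ
open import Data.List.Relation.Unary.All using () renaming (lookup to lookupAll)
open import Data.List.Relation.Unary.Any using (here; there)
open import Data.List.Reverse using (Reverse; []; _∶_∶ʳ_; reverseView)
open import Data.Nat using (ℕ; zero; suc; _+_; _≤_; _<_; z≤n; s≤s)
open import Data.Nat.Properties
open import Data.Product using (_×_; ∃-syntax; _,_; proj₁; proj₂)
open import Data.Sum using (_⊎_; inj₁; inj₂; [_,_]′)
open import Function.Base using (_∘_; id)
open import Function.Bundles using (Inverse)
open import Relation.Binary.PropositionalEquality
  using (_≡_; refl; sym; trans; cong; cong₂; subst; module ≡-Reasoning)
open import Relation.Nullary using (¬_; Dec; yes; no)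
open import Relation.Unary using (_∈_; _⊆_; _⊂_)

module _ {A : Set} where

  prefix-++ : (u t : Word A) → Prefix _≡_ u (u ++ t)
  prefix-++ []      t = []
  prefix-++ (a ∷ u) t = refl ∷ prefix-++ u t

  prefix⇒++ : {u w : Word A} → Prefix _≡_ u w → ∃[ t ] u ++ t ≡ w
  prefix⇒++ []         = _ , refl
  prefix⇒++ (refl ∷ p) with prefix⇒++ p
  ... | t , refl = t , refl

  prefix-refl : (w : Word A) → Prefix _≡_ w w
  prefix-refl w = Prefixₚ.fromPointwise (≡⇒Pointwise-≡ refl)

  prefix-comparable : {u v w : Word A} → Prefix _≡_ u w → Prefix _≡_ v w →
                      Prefix _≡_ u v ⊎ Prefix _≡_ v u
  prefix-comparable []         q          = inj₁ []
  prefix-comparable (_ ∷ _)    []         = inj₂ []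
  prefix-comparable (refl ∷ p) (refl ∷ q) with prefix-comparable p q
  ... | inj₁ r = inj₁ (refl ∷ r)
  ... | inj₂ r = inj₂ (refl ∷ r)

  prefix-∷ʳ : ∀ {u} w {c : A} → Prefix _≡_ u (w ∷ʳ c) → Prefix _≡_ u w ⊎ u ≡ w ∷ʳ c
  prefix-∷ʳ []      []          = inj₁ []
  prefix-∷ʳ []      (refl ∷ []) = inj₂ refl
  prefix-∷ʳ (a ∷ w) []          = inj₁ []
  prefix-∷ʳ (a ∷ w) (refl ∷ p)  with prefix-∷ʳ w p
  ... | inj₁ q = inj₁ (refl ∷ q)
  ... | inj₂ q = inj₂ (cong (a ∷_) q)

  proper-prefix-∷ʳ : ∀ {u} w {c : A} → Prefix _≡_ u w → ProperPrefix u (w ∷ʳ c)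
  proper-prefix-∷ʳ {u} w {c} p = p ++ᵖ [ c ] , λ u≡w∷ʳc →
    <-irrefl refl (begin-strict
      length w        <⟨ n<1+n _ ⟩
      suc (length w)  ≡⟨ +-comm 1 (length w) ⟩
      length w + 1    ≡⟨ length-++ w ⟨
      length (w ∷ʳ c) ≡⟨ cong length u≡w∷ʳc ⟨
      length u        ≤⟨ Prefixₚ.length-mono p ⟩
      length w        ∎)
    where open ≤-Reasoning

  proper-prefix-length : {u w : Word A} → ProperPrefix u w → length u < length w
  proper-prefix-length {u} {w} (p , u≢w) = ≤∧≢⇒< (Prefixₚ.length-mono p) λ eq →
    u≢w (Pointwise-≡⇒≡ (Prefixₚ.toPointwise eq p))

  proper-prefix⁻ : ∀ {u} w {c : A} → ProperPrefix u (w ∷ʳ c) → Prefix _≡_ u w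
  proper-prefix⁻ w (p , u≢) with prefix-∷ʳ w p
  ... | inj₁ q  = q
  ... | inj₂ eq = ⊥-elim (u≢ eq)

  words≤ : List A → ℕ → List (Word A)
  words≤ letters zero    = [ [] ]
  words≤ letters (suc n) = [] ∷ cartesianProductWith _∷_ letters (words≤ letters n)

  ∈-words≤ : ∀ {letters} → (∀ a → a ∈ˡ letters) →
             ∀ n w → length w ≤ n → w ∈ˡ words≤ letters n
  ∈-words≤ all zero    []      _         = here refl
  ∈-words≤ all (suc n) []      _         = here refl
  ∈-words≤ all (suc n) (a ∷ w) (s≤s len) =
    there (∈-cartesianProductWith⁺ _∷_ (all a) (∈-words≤ all n w len))

module _ {A : Set} (θ : A → A) where

  inverse-++ : ∀ u v → inverse θ (u ++ v) ≡ inverse θ v ++ inverse θ u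
  inverse-++ u v = trans (cong reverse (map-++ θ u v)) (reverse-++ (map θ u) (map θ v))

  inverse-∷ : ∀ a w → inverse θ (a ∷ w) ≡ inverse θ w ∷ʳ θ a
  inverse-∷ a w = inverse-++ [ a ] w

  inverse-∷ʳ : ∀ w c → inverse θ (w ∷ʳ c) ≡ θ c ∷ inverse θ w
  inverse-∷ʳ w c = inverse-++ w [ c ]

  suffix⇒inverse-prefix : ∀ {u w} → Suffix _≡_ u w → Prefix _≡_ (inverse θ u) (inverse θ w)
  suffix⇒inverse-prefix s = Suffixₚ.toPrefix-rev (Suffixₚ.map⁺ θ θ (Suffixₘ.map (cong θ) s))

  module _ (θ-invol : Involutive _≡_ θ) where

    inverse-involutive : Involutive _≡_ (inverse θ)
    inverse-involutive w = begin
      reverse (map θ (reverse (map θ w))) ≡⟨ cong reverse (reverse-map θ (map θ w)) ⟩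
      reverse (reverse (map θ (map θ w))) ≡⟨ reverse-involutive _ ⟩
      map θ (map θ w)                     ≡⟨ map-∘ w ⟨
      map (θ ∘ θ) w                       ≡⟨ map-cong θ-invol w ⟩
      map id w                            ≡⟨ map-id w ⟩
      w                                   ∎
      where open ≡-Reasoning

    properSuffix⇒inverse-properPrefix : ∀ {u w} →
      ProperSuffix u w → ProperPrefix (inverse θ u) (inverse θ w)
    properSuffix⇒inverse-properPrefix {u} {w} (s , u≢w) = suffix⇒inverse-prefix s , λ eq →
      u≢w (trans (sym (inverse-involutive u)) (trans (cong (inverse θ) eq) (inverse-involutive w)))

charge : {P : Set} → Dec P → ℕ
charge (yes _) = 0
charge (no _)  = 1

module Parses
  (em : ExcludedMiddle 0ℓ) {A : Set} {θ : A → A} (θ-invol : Involutive _≡_ θ)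
  {X : WordSet A} (X-bifix : BifixCode X) (X-closed : ClosedUnderInverse θ X)
  where

  open BifixCode X-bifix

  HasPrefix : Word A → Set
  HasPrefix w = ∃[ u ] (u ∈ X × Prefix _≡_ u w)

  new : Word A → ℕ
  new w = charge (em {P = HasPrefix w})

  parses : Word A → ℕ
  parses []      = 1
  parses (a ∷ w) = new (a ∷ w) + parses w

  new≡0 : ∀ {w} → HasPrefix w → new w ≡ 0
  new≡0 {w} h with em {P = HasPrefix w}
  ... | yes _ = refl
  ... | no ¬h = ⊥-elim (¬h h)

  new≡1 : ∀ {w} → ¬ HasPrefix w → new w ≡ 1
  new≡1 {w} ¬h with em {P = HasPrefix w}
  ... | yes h = ⊥-elim (¬h h)
  ... | no _  = refl

  new≤1 : ∀ w → new w ≤ 1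
  new≤1 w with em {P = HasPrefix w}
  ... | yes _ = z≤n
  ... | no _  = ≤-refl

  new-cong : ∀ {u w} → (HasPrefix u → HasPrefix w) → (HasPrefix w → HasPrefix u) →
             new u ≡ new w
  new-cong {u} f g with em {P = HasPrefix u}
  ... | yes h = sym (new≡0 (f h))
  ... | no ¬h = sym (new≡1 (¬h ∘ g))

  HasPrefix-mono : ∀ {u w} → Prefix _≡_ u w → HasPrefix u → HasPrefix w
  HasPrefix-mono p (x , x∈X , q) = x , x∈X , Prefixₚ.trans trans q p

  code⇒HasPrefix : ∀ {w} → w ∈ X → HasPrefix w
  code⇒HasPrefix {w} w∈X = w , w∈X , prefix-refl _

  HasPrefix-∷ʳ : ∀ w {c} → HasPrefix (w ∷ʳ c) → HasPrefix w ⊎ (w ∷ʳ c) ∈ X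
  HasPrefix-∷ʳ w (x , x∈X , p) with prefix-∷ʳ w p
  ... | inj₁ q    = inj₁ (x , x∈X , q)
  ... | inj₂ refl = inj₂ x∈X

  ¬HasPrefix-[] : ¬ HasPrefix []
  ¬HasPrefix-[] (.[] , x∈X , []) = nonempty x∈X refl

  code⇒¬HasPrefix : ∀ w {c} → (w ∷ʳ c) ∈ X → ¬ HasPrefix w
  code⇒¬HasPrefix w wc∈X (x , x∈X , p) = prefixFree x∈X wc∈X (proper-prefix-∷ʳ w p)

  new-∷ʳ : ∀ w {c} → ¬ (w ∷ʳ c) ∈ X → new (w ∷ʳ c) ≡ new w
  new-∷ʳ w {c} wc∉X = new-cong
    ([ id , ⊥-elim ∘ wc∉X ]′ ∘ HasPrefix-∷ʳ w)
    (HasPrefix-mono (prefix-++ w [ c ]))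

  inverse∈X⇒∈X : ∀ {w} → inverse θ w ∈ X → w ∈ X
  inverse∈X⇒∈X {w} = subst X (inverse-involutive θ θ-invol w) ∘ X-closed

  HasPrefix-[-] : ∀ {c} → HasPrefix [ c ] → [ c ] ∈ X
  HasPrefix-[-] h = [ ⊥-elim ∘ ¬HasPrefix-[] , id ]′ (HasPrefix-∷ʳ [] h)

  HasPrefix-[θ] : ∀ {c} → HasPrefix [ c ] → HasPrefix [ θ c ]
  HasPrefix-[θ] h = code⇒HasPrefix (X-closed (HasPrefix-[-] h))

  new-[θ] : ∀ c → new [ c ] ≡ new [ θ c ]
  new-[θ] c = new-cong HasPrefix-[θ]
    (λ h → subst (λ a → HasPrefix [ a ]) (θ-invol c) (HasPrefix-[θ] h))

  -- Both sides are reduced to new (a ∷ v) + new (inverse (v ∷ʳ c)), except when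
  -- a v c is in X, where prefix-freeness makes both equal to 1.
  new-exchange : ∀ a v c →
    new (a ∷ v ∷ʳ c) + new (inverse θ (v ∷ʳ c)) ≡ new (a ∷ v) + new (inverse θ (a ∷ v ∷ʳ c))
  new-exchange a v c with em {P = (a ∷ v ∷ʳ c) ∈ X}
  ... | yes w∈X =
    trans (cong₂ _+_ (new≡0 (code⇒HasPrefix w∈X))
                     (new≡1 (code⇒¬HasPrefix (inverse θ (v ∷ʳ c))
                       (subst X (inverse-∷ θ a (v ∷ʳ c)) (X-closed w∈X)))))
          (sym (cong₂ _+_ (new≡1 (code⇒¬HasPrefix (a ∷ v) w∈X))
                          (new≡0 (code⇒HasPrefix (X-closed w∈X)))))
  ... | no w∉X = cong₂ _+_ (new-∷ʳ (a ∷ v) w∉X)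
    (sym (trans (cong new (inverse-∷ θ a (v ∷ʳ c)))
                (new-∷ʳ (inverse θ (v ∷ʳ c))
                  (w∉X ∘ inverse∈X⇒∈X ∘ subst X (sym (inverse-∷ θ a (v ∷ʳ c)))))))

  parses-∷ʳ : ∀ w c → parses (w ∷ʳ c) ≡ new (inverse θ (w ∷ʳ c)) + parses w
  parses-∷ʳ []      c = cong (_+ 1) (new-[θ] c)
  parses-∷ʳ (a ∷ v) c = begin
    new (a ∷ v ∷ʳ c) + parses (v ∷ʳ c)
      ≡⟨ cong (new (a ∷ v ∷ʳ c) +_) (parses-∷ʳ v c) ⟩
    new (a ∷ v ∷ʳ c) + (new (inverse θ (v ∷ʳ c)) + parses v)
      ≡⟨ +-assoc (new (a ∷ v ∷ʳ c)) _ _ ⟨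
    new (a ∷ v ∷ʳ c) + new (inverse θ (v ∷ʳ c)) + parses v
      ≡⟨ cong (_+ parses v) (trans (new-exchange a v c) (+-comm (new (a ∷ v)) _)) ⟩
    new (inverse θ (a ∷ v ∷ʳ c)) + new (a ∷ v) + parses v
      ≡⟨ +-assoc (new (inverse θ (a ∷ v ∷ʳ c))) _ _ ⟩
    new (inverse θ (a ∷ v ∷ʳ c)) + (new (a ∷ v) + parses v) ∎
    where open ≡-Reasoning

  parses-inverse : ∀ w → parses (inverse θ w) ≡ parses w
  parses-inverse []      = refl
  parses-inverse (a ∷ w) = begin
    parses (inverse θ (a ∷ w))
      ≡⟨ cong parses (inverse-∷ θ a w) ⟩
    parses (inverse θ w ∷ʳ θ a)
      ≡⟨ parses-∷ʳ (inverse θ w) (θ a) ⟩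
    new (inverse θ (inverse θ w ∷ʳ θ a)) + parses (inverse θ w)
      ≡⟨ cong₂ _+_ (cong new (trans (cong (inverse θ) (sym (inverse-∷ θ a w)))
                                    (inverse-involutive θ θ-invol (a ∷ w))))
                   (parses-inverse w) ⟩
    new (a ∷ w) + parses w ∎
    where open ≡-Reasoning

  parses-++ʳ : ∀ s w → parses w ≤ parses (s ++ w)
  parses-++ʳ []      w = ≤-refl
  parses-++ʳ (a ∷ s) w = ≤-trans (parses-++ʳ s w) (m≤n+m _ _)

  parses-prefix : ∀ {u w} → Prefix _≡_ u w → parses u ≤ parses w
  parses-prefix {u} p with prefix⇒++ p
  ... | t , refl = begin
    parses u                             ≡⟨ parses-inverse u ⟨
    parses (inverse θ u)                 ≤⟨ parses-++ʳ (inverse θ t) (inverse θ u) ⟩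
    parses (inverse θ t ++ inverse θ u)  ≡⟨ cong parses (inverse-++ θ u t) ⟨
    parses (inverse θ (u ++ t))          ≡⟨ parses-inverse (u ++ t) ⟩
    parses (u ++ t)                      ∎
    where open ≤-Reasoning

  parses-factor : ∀ {u w} → Factor u w → parses u ≤ parses w
  parses-factor (here p)  = parses-prefix p
  parses-factor (there f) = ≤-trans (parses-factor f) (m≤n+m _ _)

  parses≤ : ∀ w → parses w ≤ suc (length w)
  parses≤ []      = ≤-refl
  parses≤ (a ∷ w) = +-mono-≤ (new≤1 (a ∷ w)) (parses≤ w)

  module Cutting (d : ℕ) where

    Cut : Word A → Set
    Cut []      = ⊥
    Cut (a ∷ v) = HasPrefix (a ∷ v) ⊎ d ≤ parses v

    MinimalCut : WordSet A
    MinimalCut w = Cut w × (∀ {u} → ProperPrefix u w → ¬ Cut u)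

    Cut-mono : ∀ {u w} → Prefix _≡_ u w → Cut u → Cut w
    Cut-mono (refl ∷ p) (inj₁ h)   = inj₁ (HasPrefix-mono (refl ∷ p) h)
    Cut-mono (refl ∷ p) (inj₂ d≤) = inj₂ (≤-trans d≤ (parses-prefix p))

    minimalCut-∷ʳ : ∀ w {c} → Cut (w ∷ʳ c) → ¬ Cut w → MinimalCut (w ∷ʳ c)
    minimalCut-∷ʳ w cut ¬cut = cut , λ p → ¬cut ∘ Cut-mono (proper-prefix⁻ w p)

    minimalCut-prefix : ∀ {w} → Reverse w → Cut w → ∃[ u ] (MinimalCut u × Prefix _≡_ u w)
    minimalCut-prefix (w ∶ rs ∶ʳ c) cut with em {P = Cut w}
    ... | no ¬cut = w ∷ʳ c , minimalCut-∷ʳ w cut ¬cut , prefix-refl _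
    ... | yes cut′ with minimalCut-prefix rs cut′
    ...   | u , min , p = u , min , p ++ᵖ [ c ]

    minimalCut-prefixFree : ∀ {u w} → u ∈ MinimalCut → w ∈ MinimalCut → ¬ ProperPrefix u w
    minimalCut-prefixFree (cut , _) (_ , min) p = min p cut

    minimalCut-inverse : ClosedUnderInverse θ MinimalCut
    minimalCut-inverse {a ∷ w} (cut , min) with initLast w
    ... | [] = minimalCut-∷ʳ [] ([ inj₁ ∘ HasPrefix-[θ] , inj₂ ]′ cut) λ ()
    ... | v ∷ʳ′ b = subst MinimalCut (sym w⁻-eq) (cut⁻ cut)
      where
      v⁻ = inverse θ v

      w⁻-eq : inverse θ (a ∷ v ∷ʳ b) ≡ θ b ∷ v⁻ ∷ʳ θ a
      w⁻-eq = trans (inverse-∷ θ a (v ∷ʳ b)) (cong (_∷ʳ θ a) (inverse-∷ʳ θ v b))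

      ¬cut-av : ¬ Cut (a ∷ v)
      ¬cut-av = min (proper-prefix-∷ʳ (a ∷ v) (prefix-refl _))

      d≰parses-v : ¬ d ≤ parses v
      d≰parses-v = ¬cut-av ∘ inj₂

      ¬cut-bv⁻ : ¬ HasPrefix (θ b ∷ v⁻) → ¬ Cut (θ b ∷ v⁻)
      ¬cut-bv⁻ ¬h (inj₁ h)  = ¬h h
      ¬cut-bv⁻ ¬h (inj₂ d≤) = d≰parses-v (subst (d ≤_) (parses-inverse v) d≤)

      cut⁻ : Cut (a ∷ v ∷ʳ b) → MinimalCut (θ b ∷ v⁻ ∷ʳ θ a)
      cut⁻ (inj₁ h) with HasPrefix-∷ʳ (a ∷ v) h
      ... | inj₁ h′  = ⊥-elim (¬cut-av (inj₁ h′))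
      ... | inj₂ w∈X = minimalCut-∷ʳ (θ b ∷ v⁻) (inj₁ (code⇒HasPrefix w⁻∈X))
                         (¬cut-bv⁻ (code⇒¬HasPrefix (θ b ∷ v⁻) w⁻∈X))
        where
        w⁻∈X : (θ b ∷ v⁻ ∷ʳ θ a) ∈ X
        w⁻∈X = subst X w⁻-eq (X-closed w∈X)
      cut⁻ (inj₂ d≤) = minimalCut-∷ʳ (θ b ∷ v⁻) (inj₂ d≤parses) (¬cut-bv⁻ ¬h)
        where
        open ≤-Reasoning

        ¬h : ¬ HasPrefix (θ b ∷ v⁻)
        ¬h h = d≰parses-v (begin
          d                                      ≤⟨ d≤ ⟩
          parses (v ∷ʳ b)                        ≡⟨ parses-∷ʳ v b ⟩
          new (inverse θ (v ∷ʳ b)) + parses v    ≡⟨ cong (λ u → new u + parses v) (inverse-∷ʳ θ v b) ⟩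
          new (θ b ∷ v⁻) + parses v              ≡⟨ cong (_+ parses v) (new≡0 h) ⟩
          parses v                               ∎)

        d≤parses : d ≤ parses (v⁻ ∷ʳ θ a)
        d≤parses = begin
          d                                      ≤⟨ d≤ ⟩
          parses (v ∷ʳ b)                        ≡⟨ parses-∷ʳ v b ⟩
          new (inverse θ (v ∷ʳ b)) + parses v    ≤⟨ +-monoˡ-≤ _ (new≤1 _) ⟩
          1 + parses v                           ≡⟨ cong (_+ parses v) (new≡1 (¬cut-av ∘ inj₁)) ⟨
          parses (a ∷ v)                         ≡⟨ parses-inverse (a ∷ v) ⟨
          parses (inverse θ (a ∷ v))             ≡⟨ cong parses (inverse-∷ θ a v) ⟩
          parses (v⁻ ∷ʳ θ a)                     ∎

    minimalCut-suffixFree : ∀ {u w} → u ∈ MinimalCut → w ∈ MinimalCut → ¬ ProperSuffix u w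
    minimalCut-suffixFree u∈ w∈ s = minimalCut-prefixFree
      (minimalCut-inverse u∈) (minimalCut-inverse w∈) (properSuffix⇒inverse-properPrefix θ θ-invol s)

    X⊆minimalCut : (∀ {x} → x ∈ X → length x ≤ d) → X ⊆ MinimalCut
    X⊆minimalCut X≤d {[]}    x∈X = ⊥-elim (nonempty x∈X refl)
    X⊆minimalCut X≤d {a ∷ x} x∈X = inj₁ (code⇒HasPrefix x∈X) , min
      where
      min : ∀ {u} → ProperPrefix u (a ∷ x) → ¬ Cut u
      min {_ ∷ _} p@(q , _) (inj₁ (y , y∈X , r)) = prefixFree y∈X x∈X
        (Prefixₚ.trans trans r q , λ { refl →
          <-irrefl refl (<-≤-trans (proper-prefix-length p) (Prefixₚ.length-mono r)) })
      min {_ ∷ v} p (inj₂ d≤) = <-irrefl refl (begin-strict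
        suc (length v) <⟨ proper-prefix-length p ⟩
        length (a ∷ x) ≤⟨ X≤d x∈X ⟩
        d              ≤⟨ d≤ ⟩
        parses v       ≤⟨ parses≤ v ⟩
        suc (length v) ∎)
        where open ≤-Reasoning

    maximiser-cut : ∀ {S : WordSet A} {u} →
      d ≤ parses u ⊎ (∀ {w} → w ∈ S → parses w ≤ parses u) →
      ∀ {a v} → (a ∷ v) ∈ S → Factor u v → Cut (a ∷ v)
    maximiser-cut (inj₁ d≤) _ f = inj₂ (≤-trans d≤ (parses-factor f))
    maximiser-cut {u = u} (inj₂ max) {a} {v} av∈S f with em {P = HasPrefix (a ∷ v)}
    ... | yes h = inj₁ h
    ... | no ¬h = ⊥-elim (<-irrefl refl (begin-strict
      parses v       <⟨ n<1+n _ ⟩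
      1 + parses v   ≡⟨ cong (_+ parses v) (new≡1 ¬h) ⟨
      parses (a ∷ v) ≤⟨ max av∈S ⟩
      parses u       ≤⟨ parses-factor f ⟩
      parses v       ∎))
      where open ≤-Reasoning

module _ (em : ExcludedMiddle 0ℓ) where

  finite-⊆ : {A : Set} {P : WordSet A} (ws : List (Word A)) → P ⊆ (_∈ˡ ws) → Finite P
  finite-⊆ {P = P} ws P⊆ws = filter P? ws ,
    (λ p → ∈-filter⁺ P? (P⊆ws p) p) , (λ w∈ → proj₂ (∈-filter⁻ P? {xs = ws} w∈))
    where
    P? : ∀ w → Dec (P w)
    P? w = em

  infinite⇒inhabited : {A : Set} {P : WordSet A} → Infinite P → ∃[ w ] w ∈ P
  infinite⇒inhabited {P = P} inf with em {P = ∃[ w ] w ∈ P}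
  ... | yes p = p
  ... | no ¬p = ⊥-elim (inf ([] , (λ {w} w∈P → ⊥-elim (¬p (w , w∈P))) , λ ()))

  bounded-maximiser : {A : Set} {P : WordSet A} (f : Word A → ℕ) (d : ℕ) → ∃[ w ] w ∈ P →
    ∃[ u ] (u ∈ P × (d ≤ f u ⊎ (∀ {w} → w ∈ P → f w ≤ f u)))
  bounded-maximiser {P = P} f d (w₀ , w₀∈P) = climb d w₀∈P (m≤m+n d (f w₀))
    where
    climb : ∀ k {u} → u ∈ P → d ≤ k + f u →
            ∃[ u ] (u ∈ P × (d ≤ f u ⊎ (∀ {w} → w ∈ P → f w ≤ f u)))
    climb zero    {u} u∈P d≤ = u , u∈P , inj₁ d≤
    climb (suc k) {u} u∈P d≤ with em {P = ∃[ w ] (w ∈ P × f u < f w)}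
    ... | yes (w , w∈P , fu<fw) = climb k w∈P
      (≤-trans d≤ (≤-trans (≤-reflexive (sym (+-suc k (f u)))) (+-monoʳ-≤ k fu<fw)))
    ... | no ¬larger = u , u∈P , inj₂ λ {w} w∈P → ≮⇒≥ λ fu<fw → ¬larger (w , w∈P , fu<fw)

recurrent-long : {A : Set} {S : WordSet A} → UniformlyRecurrent S → ∀ {u} → u ∈ S →
                 ∃[ n ] (∀ {w} → w ∈ S → n ≤ length w → Factor u w)
recurrent-long ur u∈S with UniformlyRecurrent.recurrent ur u∈S
... | n , _ , occurs = n , λ {w} w∈S n≤ → subst (Factor _) (take++drop≡id n w)
  (occurs (Factorial.factors (UniformlyRecurrent.factorial ur) w∈S
             (subst (Factor _) (take++drop≡id n w) (here (prefix-++ (take n w) (drop n w)))))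
          (trans (length-take n w) (m≤n⇒m⊓n≡m n≤))
   ⁱ++ drop n w)

right-extension : {A : Set} {S : WordSet A} → Biextendable S → ∀ n {w} → w ∈ S →
                  ∃[ t ] (n ≤ length t × (w ++ t) ∈ S)
right-extension {S = S} be zero {w} w∈S = [] , z≤n , subst S (sym (++-identityʳ w)) w∈S
right-extension {S = S} be (suc n) {w} w∈S with Biextendable.extend be w∈S
... | a , b , awb∈S with right-extension be n
        (Factorial.factors (Biextendable.factorial be) awb∈S
          (there (here (prefix-refl _))))
...   | t , n≤ , wbt∈S = b ∷ t , s≤s n≤ , subst S (++-assoc w [ b ] t) wbt∈S

theorem8p2 : ExcludedMiddle 0ℓ →
    (A : Set) → IsFiniteType A →
    (θ : A → A) → Involutive _≡_ θ →
    (S : WordSet A) → Laminary θ S → UniformlyRecurrent S →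
    (X : WordSet A) → BifixCode X → X ⊆ S → Finite X → Symmetric θ X →
    ∃[ Y ] (Finite Y × Symmetric θ Y × MaximalBifixCode S Y × X ⊆ Y)
theorem8p2 em A (k , A↔Fin) θ θ-invol S S-lam S-ur X X-bifix X⊆S (xs , X≐xs) X-sym =
  Y , Y-finite , Y-symmetric , Y-maximal , λ x∈X → X⊆S x∈X , X⊆minimalCut X≤d x∈X
  where
  open Parses em θ-invol X-bifix (Symmetric.closed X-sym)

  d : ℕ
  d = max 0 (map length xs)

  open Cutting d

  X≤d : ∀ {x} → x ∈ X → length x ≤ d
  X≤d x∈X = lookupAll (xs≤max 0 (map length xs)) (∈-map⁺ length (proj₁ X≐xs x∈X))

  Y : WordSet A
  Y w = w ∈ S × w ∈ MinimalCut

  S-factors : ∀ {u w} → w ∈ S → Factor u w → u ∈ S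
  S-factors = Factorial.factors (UniformlyRecurrent.factorial S-ur)

  long-cut : ∃[ n ] (∀ {w} → w ∈ S → n < length w → Cut w)
  long-cut with bounded-maximiser em {P = S} parses d
                  (infinite⇒inhabited em (UniformlyRecurrent.infinite S-ur))
  ... | u , u∈S , max-u with recurrent-long S-ur u∈S
  ...   | n , occurs = n , λ { {a ∷ v} av∈S (s≤s n≤) →
    maximiser-cut max-u av∈S (occurs (S-factors av∈S (there (here (prefix-refl v)))) n≤) }

  n = proj₁ long-cut

  Y-short : ∀ {w} → w ∈ Y → length w ≤ suc n
  Y-short {w} w∈Y with initLast w
  Y-short (_ , () , _) | []
  Y-short (wc∈S , _ , min) | w ∷ʳ′ c = subst (_≤ suc n) (sym (trans (length-++ w) (+-comm _ 1)))
    (s≤s (≮⇒≥ λ n< → min (proper-prefix-∷ʳ w (prefix-refl _))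
      (proj₂ long-cut (S-factors wc∈S (here (prefix-++ w [ c ]))) n<)))

  letters : List A
  letters = map (Inverse.from A↔Fin) (allFin k)

  ∈-letters : ∀ a → a ∈ˡ letters
  ∈-letters a = subst (_∈ˡ letters) (Inverse.strictlyInverseʳ A↔Fin a)
                  (∈-map⁺ (Inverse.from A↔Fin) (∈-allFin (Inverse.to A↔Fin a)))

  Y-finite : Finite Y
  Y-finite = finite-⊆ em (words≤ letters (suc n))
    λ {w} w∈Y → ∈-words≤ ∈-letters (suc n) w (Y-short w∈Y)

  Y-symmetric : Symmetric θ Y
  Y-symmetric = record
    { reduced = λ (w∈S , _) → Laminary.reduced S-lam w∈S
    ; closed  = λ (w∈S , w∈C) → Laminary.closed S-lam w∈S , minimalCut-inverse w∈C
    }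

  maximal : ∀ (Z : WordSet A) → BifixCode Z → Z ⊆ S → ¬ (Y ⊂ Z)
  maximal Z Z-bifix Z⊆S (Y⊆Z , Z⊈Y) = Z⊈Y λ {z} z∈Z → Z⊆Y z∈Z
    where
    Z⊆Y : Z ⊆ Y
    Z⊆Y {z} z∈Z with right-extension (Laminary.biextendable S-lam) (suc n) (Z⊆S z∈Z)
    ... | t , n< , zt∈S with minimalCut-prefix (reverseView (z ++ t))
            (proj₂ long-cut zt∈S (≤-trans n< (subst (length t ≤_) (sym (length-++ z)) (m≤n+m _ _))))
    ...   | y , y∈C , y-prefix = subst Y y≡z y∈Y
      where
      y∈Y : y ∈ Y
      y∈Y = S-factors zt∈S (here y-prefix) , y∈C

      y≡z : y ≡ z
      y≡z with em {P = y ≡ z} | prefix-comparable y-prefix (prefix-++ z t)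
      ... | yes eq | _      = eq
      ... | no y≢z | inj₁ p = ⊥-elim (BifixCode.prefixFree Z-bifix (Y⊆Z y∈Y) z∈Z (p , y≢z))
      ... | no y≢z | inj₂ p = ⊥-elim (BifixCode.prefixFree Z-bifix z∈Z (Y⊆Z y∈Y) (p , y≢z ∘ sym))

  Y-maximal : MaximalBifixCode S Y
  Y-maximal = record
    { bifix = record
      { nonempty   = λ { (_ , () , _) refl }
      ; prefixFree = λ (_ , u∈C) (_ , w∈C) → minimalCut-prefixFree u∈C w∈C
      ; suffixFree = λ (_ , u∈C) (_ , w∈C) → minimalCut-suffixFree u∈C w∈C
      }
    ; within  = proj₁
    ; maximal = maximal
    }
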